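{- Let $V=(v_{ij})\in(\mathbb R\cup\{\infty\})^{d\times n}$ and let $\Psi$ be a subgraph of the complete bipartite graph $[d]\times[n]$. If $V$ is tropically generic with respect to the tropical semiring $\mathbb T_{\min}$, then the max-tropical cone $\operatorname{thalf}(V,\Psi)$ is pure and full-dimensional.
   Context: $\mathbb T_{\min}=(\mathbb R\cup\{\infty\},\min,+)$. Subgraphs of the complete bipartite graph $[d]\times[n]$ are identified with sets of arcs $(i,j)$, $i\in[d]$, $j\in[n]$. $v^{(j)}$ denotes the $j$th column of $V$, assumed not identically $\infty$. For $u\in\mathbb T_{\min}^d$ and $i$ with $u_i\neq\infty$ the sector is $S_i(u)=\{z\in\mathbb R^d : z_\ell-z_i\le u_\ell-u_i \text{ for all }\ell\in[d]\text{ with }u_\ell\ne\infty\}$ (for $u_i=\infty$ put $S_i(u)=\emptyset$). Define $$\operatorname{thalf}(V,\Psi)=\bigcap_{j\in[n]}\ \bigcup_{i:(i,j)\in\Psi}S_i(v^{(j)})\subseteq\mathbb R^d .$$ The sectors $S_i(u)$ with $u_i\neq\infty$ are the maximal cells of a polyhedral complex $\Delta(u)$ covering $\mathbb R^d$ (its cells are intersections of nonempty families of these sectors). The covector decomposition $\mathcal T(V)$ of $\mathbb R^d$ is the common refinement of $\Delta(v^{(1)}),\dots,\Delta(v^{(n)})$. The set $\operatorname{thalf}(V,\Psi)$ is a union of cells of $\mathcal T(V)$, and its covector decomposition consists of the cells of $\mathcal T(V)$ contained in it. The cone is pure if all inclusion-maximal cells of its covector decomposition have the same dimension; it is pure and full-dimensional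 if all these inclusion-maximal cells have dimension $d$ (a vacuous condition if $\operatorname{thalf}(V,\Psi)=\emptyset$). The tropical determinant of a square matrix $W=(w_{ij})\in\mathbb T_{\min}^{k\times k}$ is $\operatorname{tdet}W=\min_{\sigma\in\operatorname{Sym}(k)}(w_{1,\sigma(1)}+\dots+w_{k,\sigma(k)})$. It vanishes if this minimum equals $\infty$ or is attained at least twice (by at least two permutations). A matrix is tropically generic if the tropical determinant of no square submatrix vanishes. -}

module Defs where

open import Level using (0ℓ; suc)
open import Algebra.Bundles using (CommutativeRing; RawMonoid)
import Algebra.Definitions.RawMonoid as RawMonoidOps
open import Data.Fin.Base using (Fin)
open import Data.Fin.Permutation using (Permutation′; _⟨$⟩ʳ_)
  renaming (_≈_ to _≈ₚ_)
open import Data.Maybe.Base using (zipWith)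
open import Data.Nat.Base using (ℕ) renaming (suc to 1+_)
open import Data.Product.Base using (Σ-syntax; ∃-syntax; _×_; _,_)
open import Data.Sum.Base using (_⊎_)
open import Data.Vec.Functional using (Vector)
open import Function.Definitions using (Injective)
open import Relation.Binary.Core using (Rel)
open import Relation.Binary.Structures using (IsTotalOrder)
open import Relation.Binary.PropositionalEquality.Core using (_≡_)
open import Relation.Nullary.Construct.Add.Supremum using (_⁺; ⊤⁺; [_])
open import Relation.Nullary.Negation.Core using (¬_)
open import Relation.Unary using (Pred; _∈_; _⊆_; _≐_; ⋂; Satisfiable)
import Relation.Binary.Construct.Add.Supremum.Equality as AddSupEquality
import Relation.Binary.Construct.Add.Supremum.NonStrict as AddSupNonStrict

-- The textbook axioms of ℝ.  Under excluded middle they determine ℝ up to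
-- isomorphism; they are not meant as a constructive theory of real numbers.

record CompleteOrderedField : Set (suc 0ℓ) where
  field
    commutativeRing : CommutativeRing 0ℓ 0ℓ

  open CommutativeRing commutativeRing public

  infix 4 _≤_

  field
    _≤_          : Rel Carrier 0ℓ
    isTotalOrder : IsTotalOrder _≈_ _≤_
    1≉0          : ¬ 1# ≈ 0#
    inverse      : ∀ x → ¬ x ≈ 0# → ∃[ y ] x * y ≈ 1#
    +-monoˡ-≤    : ∀ z {x y} → x ≤ y → x + z ≤ y + z
    *-nonneg     : ∀ {x y} → 0# ≤ x → 0# ≤ y → 0# ≤ x * y

  IsUpperBound : Pred Carrier 0ℓ → Pred Carrier 0ℓ
  IsUpperBound P b = ∀ x → x ∈ P → x ≤ b

  field
    supremum : ∀ P → Satisfiable P → Satisfiable (IsUpperBound P) →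
               ∃[ s ] IsUpperBound P s × (∀ b → IsUpperBound P b → s ≤ b)

module Tropical (ℝ : CompleteOrderedField) where

  open CompleteOrderedField ℝ

  𝕋 : Set
  𝕋 = Carrier ⁺

  open AddSupEquality _≈_ public using (_≈⁺_)
  open AddSupNonStrict _≤_ public using (_≤⁺_)

  -- The multiplicative monoid of 𝕋: addition of reals, with ∞ absorbing.
  ⊙-rawMonoid : RawMonoid 0ℓ 0ℓ
  ⊙-rawMonoid = record
    { Carrier = 𝕋
    ; _≈_     = _≈⁺_
    ; _∙_     = zipWith _+_
    ; ε       = [ 0# ]
    }

  open RawMonoidOps ⊙-rawMonoid public using () renaming (sum to sum⁺)

  Matrix : ℕ → ℕ → Set
  Matrix d n = Fin d → Fin n → 𝕋

  column : ∀ {d n} → Matrix d n → Fin n → Vector 𝕋 d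
  column V j i = V i j

  IsMinimum : {I : Set} → (I → 𝕋) → Pred 𝕋 0ℓ
  IsMinimum f m = (∀ i → m ≤⁺ f i) × (∃[ i ] f i ≈⁺ m)

  weight : ∀ {k} → Matrix k k → Permutation′ k → 𝕋
  weight W σ = sum⁺ (λ i → W i (σ ⟨$⟩ʳ i))

  IsTdet : ∀ {k} → Matrix k k → Pred 𝕋 0ℓ
  IsTdet W = IsMinimum (weight W)

  TdetVanishes : ∀ {k} → Matrix k k → Set
  TdetVanishes W = ∃[ m ] m ∈ IsTdet W ×
    (m ≡ ⊤⁺ ⊎ (∃[ σ ] ∃[ τ ] ¬ σ ≈ₚ τ × weight W σ ≈⁺ m × weight W τ ≈⁺ m))

  -- The rows and columns of a submatrix are enumerated by injections that
  -- need not be monotone: reordering rows or columns permutes the terms of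
  -- the tropical determinant, so it does not affect vanishing.
  TropicallyGeneric : ∀ {d n} → Matrix d n → Set
  TropicallyGeneric {d} {n} V =
    ∀ k (r : Fin k → Fin d) (c : Fin k → Fin n) →
    Injective _≡_ _≡_ r → Injective _≡_ _≡_ c →
    ¬ TdetVanishes (λ a b → V (r a) (c b))

  Point : ℕ → Set
  Point d = Vector Carrier d

  -- Empty when u i is ∞, since then no a satisfies u i ≡ [ a ].
  Sector : ∀ {d} → Vector 𝕋 d → Fin d → Pred (Point d) 0ℓ
  Sector u i z = ∃[ a ] u i ≡ [ a ] ×
    (∀ l b → u l ≡ [ b ] → z l - z i ≤ b - a)

  Subgraph : ℕ → ℕ → Set₁
  Subgraph d n = Pred (Fin d × Fin n) 0ℓ

  thalf : ∀ {d n} → Matrix d n → Subgraph d n → Pred (Point d) 0ℓ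
  thalf V Ψ z = ∀ j → ∃[ i ] (i , j) ∈ Ψ × z ∈ Sector (column V j) i

  IsCellOfΔ : ∀ {d} → Vector 𝕋 d → Pred (Pred (Point d) 0ℓ) (suc 0ℓ)
  IsCellOfΔ {d} u C = Σ[ I ∈ Pred (Fin d) 0ℓ ]
    Satisfiable I ×
    (∀ i → i ∈ I → ∃[ a ] u i ≡ [ a ]) ×
    C ≐ (λ z → ∀ i → i ∈ I → z ∈ Sector u i)

  -- Cells of the common refinement are the nonempty intersections of one
  -- cell from each Δ (column V j); for n = 0 the only cell is ℝᵈ.
  IsCell : ∀ {d n} → Matrix d n → Pred (Pred (Point d) 0ℓ) (suc 0ℓ)
  IsCell {d} {n} V C = Σ[ D ∈ (Fin n → Pred (Point d) 0ℓ) ]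
    (∀ j → IsCellOfΔ (column V j) (D j)) ×
    C ≐ ⋂ (Fin n) D ×
    Satisfiable C

  IsCellOfThalf : ∀ {d n} → Matrix d n → Subgraph d n →
                  Pred (Pred (Point d) 0ℓ) (suc 0ℓ)
  IsCellOfThalf V Ψ C = IsCell V C × C ⊆ thalf V Ψ

  IsMaximalCellOfThalf : ∀ {d n} → Matrix d n → Subgraph d n →
                         Pred (Pred (Point d) 0ℓ) (suc 0ℓ)
  IsMaximalCellOfThalf V Ψ C = IsCellOfThalf V Ψ C ×
    (∀ C′ → IsCellOfThalf V Ψ C′ → C ⊆ C′ → C ≐ C′)

  open RawMonoidOps +-rawMonoid public using (sum)

  combination : ∀ {d k} → Vector Carrier k → Vector (Point d) k → Point d
  combination c p l = sum (λ m → c m * p m l)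

  AffinelyIndependent : ∀ {d k} → Vector (Point d) k → Set
  AffinelyIndependent p = ∀ c → sum c ≈ 0# →
    (∀ l → combination c p l ≈ 0#) → ∀ m → c m ≈ 0#

  AffineSpan : ∀ {d k} → Vector (Point d) k → Pred (Point d) 0ℓ
  AffineSpan p z = ∃[ c ] sum c ≈ 1# × (∀ l → z l ≈ combination c p l)

  -- The affine hull of C is k-dimensional: k + 1 points of C form an affine
  -- basis of it.
  HasDimension : ∀ {d} → Pred (Point d) 0ℓ → ℕ → Set
  HasDimension {d} C k = Σ[ p ∈ Vector (Point d) (1+ k) ]
    (∀ m → p m ∈ C) × AffinelyIndependent p × C ⊆ AffineSpan p

  PureOfDimension : ∀ {d n} → Matrix d n → Subgraph d n → ℕ → Set₁
  PureOfDimension V Ψ k =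
    ∀ C → IsMaximalCellOfThalf V Ψ C → HasDimension C k

  PureFullDimensional : ∀ {d n} → Matrix d n → Subgraph d n → Set₁
  PureFullDimensional {d} V Ψ = PureOfDimension V Ψ d

{-# OPTIONS --safe #-}
module Submission where

-- The 1 × 1 minors force V to be finite.  A maximal cell C has a point z that
-- lies in a sector only if all of C does; choosing at z a sector (f j , j) ∈ Ψ
-- for every j gives a cell, the intersection of these sectors, that lies in the
-- cone and contains C, hence equals C.  Write l ≺ f j when l ≠ f j and z also
-- lies in the sector l of column j.  A cycle of ≺ would give two matchings of
-- some rows with some columns, both attaining the tropical determinant of the
-- submatrix.  So ≺ is acyclic, and moving z a little along a rank function of ≺
-- leads into the interior of the cell, where a small simplex fits.

open import Defs
open import Level using (0ℓ)
open import Axiom.ExcludedMiddle using (ExcludedMiddle)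
open import Data.Nat.Base using (ℕ)
open import Data.Fin.Base using (Fin)
open import Data.Product.Base using (∃-syntax)
open import Relation.Binary.PropositionalEquality.Core using (_≡_)
open import Relation.Nullary.Construct.Add.Supremum using ([_])

import Algebra.Properties.CommutativeSemigroup as CommutativeSemigroupProperties
import Algebra.Properties.Group as GroupProperties
import Algebra.Properties.Ring as RingProperties
import Algebra.Properties.Semiring.Sum as SemiringSum
import Algebra.Solver.Ring.NaturalCoefficients.Default as SemiringSolver
open import Data.Empty using (⊥-elim)
open import Data.Fin.Base using (zero; suc; toℕ; fromℕ; punchIn; combine; remQuot)
import Data.Fin.Properties as Fin
open import Data.Fin.Permutation as Permutation
  using (Permutation′; _⟨$⟩ʳ_; _⟨$⟩ˡ_; insert; inverseˡ; inverseʳ)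
  renaming (_≈_ to _≈ₚ_)
open import Data.Maybe.Base using (just; nothing; zipWith)
open import Data.Nat.Base as ℕ using (zero; suc; z≤n; s≤s)
open import Data.Nat.Induction using (<-rec)
import Data.Nat.Properties as ℕ
open import Data.Product.Base using (_×_; _,_; proj₁; proj₂)
open import Data.Sum.Base using (inj₁; inj₂; [_,_]′)
open import Data.Vec.Functional using (Vector)
open import Function.Definitions using (Injective)
open import Relation.Binary.Bundles using (Poset)
open import Relation.Binary.Construct.Add.Supremum.NonStrict using (_≤⊤⁺)
import Relation.Binary.Construct.Add.Supremum.NonStrict as NonStrict
import Relation.Binary.Construct.Add.Supremum.Equality as Equality
open import Relation.Binary.Construct.Closure.Transitive using (TransClosure; [_]; _∷_; _++_)
open import Relation.Binary.Core using (Rel)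
open import Relation.Binary.Definitions using (tri<; tri≈; tri>)
import Relation.Binary.PropositionalEquality.Core as ≡
import Relation.Binary.Reasoning.PartialOrder as PartialOrderReasoning
open import Relation.Binary.Structures using (IsTotalOrder)
open import Relation.Nullary.Construct.Add.Supremum using (⊤⁺)
open import Relation.Nullary.Decidable.Core using (Dec; yes; no)
open import Relation.Nullary.Negation.Core using (¬_)
open import Relation.Unary using (Pred; _∈_; _⊆_; Satisfiable)

-- Closed walks of a relation and their reduction to simple ones.

module _ {A : Set} (R : Rel A 0ℓ) where

  -- A walk has `suc k` edges, so it is never empty. Vertices are indexed by `ℕ` so that a subwalk
  -- is a mere shift of the argument; values beyond `suc k` are arbitrary.
  record ClosedWalk (k : ℕ) : Set where
    field
      vertex : ℕ → A
      edge   : ∀ t → t ℕ.< suc k → R (vertex t) (vertex (suc t))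
      closed : vertex (suc k) ≡ vertex 0

  open ClosedWalk

  Simple : ∀ {k} → ClosedWalk k → Set
  Simple {k} c = ∀ s t → s ℕ.< suc k → t ℕ.< suc k → vertex c s ≡ vertex c t → s ≡ t

  ⁺⇒walk : ∀ {x y} → TransClosure R x y → ∃[ c ] ∃[ k ]
           c 0 ≡ x × c (suc k) ≡ y × (∀ t → t ℕ.< suc k → R (c t) (c (suc t)))
  ⁺⇒walk {x} {y} [ r ] = c , 0 , ≡.refl , ≡.refl , λ { zero _ → r ; (suc t) (s≤s ()) }
    where
    c : ℕ → A
    c zero    = x
    c (suc t) = y
  ⁺⇒walk {x} (r ∷ rs) with ⁺⇒walk rs
  ... | c , k , ≡.refl , end , e = c′ , suc k , ≡.refl , end ,
        λ { zero _ → r ; (suc t) (s≤s t<k) → e t t<k }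
    where
    c′ : ℕ → A
    c′ zero    = x
    c′ (suc t) = c t

  ⁺⇒closedWalk : ∀ {x} → TransClosure R x x → ∃[ k ] ClosedWalk k
  ⁺⇒closedWalk rs with ⁺⇒walk rs
  ... | c , k , start , end , e = k , record
        { vertex = c ; edge = e ; closed = ≡.trans end (≡.sym start) }

  shorten : ∀ {k} (c : ClosedWalk k) a l → l ℕ.+ suc a ℕ.< suc k →
            vertex c (suc l ℕ.+ a) ≡ vertex c a → ClosedWalk l
  shorten {k} c a l b<k eq = record
    { vertex = λ t → vertex c (t ℕ.+ a)
    ; edge   = λ t t≤l → edge c (t ℕ.+ a)
        (ℕ.<-trans (ℕ.+-monoˡ-< a t≤l) (≡.subst (ℕ._< suc k) (ℕ.+-suc l a) b<k))
    ; closed = eq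
    }

  -- Strong induction on the length: the stretch between two visits to the same vertex is itself a
  -- closed walk, and a shorter one.
  simpleWalk : ExcludedMiddle 0ℓ → ∀ k → ClosedWalk k → ∃[ l ] ∃[ c ] Simple {l} c
  simpleWalk em = <-rec _ step
    where
    step : ∀ k → (∀ {l} → l ℕ.< k → ClosedWalk l → ∃[ l ] ∃[ c ] Simple {l} c) →
           ClosedWalk k → ∃[ l ] ∃[ c ] Simple {l} c
    step k rec c with em {∃[ a ] ∃[ l ] l ℕ.+ suc a ℕ.< suc k × vertex c (suc l ℕ.+ a) ≡ vertex c a}
    ... | yes (a , l , b<k , eq) =
      rec (ℕ.<-≤-trans (ℕ.m<m+n l (s≤s z≤n)) (ℕ.s≤s⁻¹ b<k)) (shorten c a l b<k eq)
    ... | no ¬rep = k , c , simple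
      where
      distinct : ∀ s t → s ℕ.< t → t ℕ.< suc k → ¬ vertex c t ≡ vertex c s
      distinct s t s<t t<k eq with ℕ.m≤n⇒∃[o]m+o≡n s<t
      ... | l , ≡.refl = ¬rep (s , l ,
        ≡.subst (ℕ._< suc k) (ℕ.+-comm (suc s) l) t<k ,
        ≡.trans (≡.cong (λ m → vertex c (suc m)) (ℕ.+-comm l s)) eq)
      simple : Simple c
      simple s t s<k t<k eq with ℕ.<-cmp s t
      ... | tri< s<t _ _ = ⊥-elim (distinct s t s<t t<k (≡.sym eq))
      ... | tri≈ _ s≡t _ = s≡t
      ... | tri> _ _ t<s = ⊥-elim (distinct t s t<s s<k eq)

-- The cyclic shift, and points in general position.

backwardShift : ∀ k → Permutation′ (suc k)
backwardShift k = insert zero (fromℕ k) Permutation.id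

-- Only the top index is skipped, so no value changes. Hence `backwardShift` is the cycle that
-- lowers each index by one and sends `zero` to the last.
toℕ-punchIn-fromℕ : ∀ k (i : Fin k) → toℕ (punchIn (fromℕ k) i) ≡ toℕ i
toℕ-punchIn-fromℕ (suc k) zero    = ≡.refl
toℕ-punchIn-fromℕ (suc k) (suc i) = ≡.cong suc (toℕ-punchIn-fromℕ k i)

-- Averaging (mid) makes fewer of the P i hold, so for finitely many P i some
-- point of C satisfies only those that hold on all of C.
genericPoint : ExcludedMiddle 0ℓ → {X : Set} (C : Pred X 0ℓ) {N : ℕ} (P : Fin N → Pred X 0ℓ) →
  (∀ x y → x ∈ C → y ∈ C → ∃[ m ] m ∈ C × (∀ i → m ∈ P i → x ∈ P i × y ∈ P i)) →
  Satisfiable C → ∃[ x ] x ∈ C × (∀ i → x ∈ P i → C ⊆ P i)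
genericPoint em C {zero}  P mid (x , x∈C) = x , x∈C , λ ()
genericPoint em C {suc N} P mid sat
  with genericPoint em C (λ i → P (suc i))
         (λ x y x∈C y∈C → let m , m∈C , h = mid x y x∈C y∈C in m , m∈C , λ i → h (suc i)) sat
     | em {∃[ y ] y ∈ C × ¬ y ∈ P zero}
... | x , x∈C , gen | yes (y , y∈C , y∉P) =
  let m , m∈C , h = mid x y x∈C y∈C in
  m , m∈C , λ { zero m∈P → ⊥-elim (y∉P (proj₂ (h zero m∈P)))
              ; (suc i) m∈P → gen i (proj₁ (h (suc i) m∈P)) }
... | x , x∈C , gen | no ¬y = x , x∈C , λ { zero _ → all ; (suc i) → gen i }
  where
  all : C ⊆ P zero
  all {y} y∈C with em {y ∈ P zero}
  ... | yes y∈P = y∈P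
  ... | no y∉P  = ⊥-elim (¬y (y , y∈C , y∉P))

-- Inequalities, positivity and finite sums in an ordered field.

module OrderedFieldProperties (ℝ : CompleteOrderedField) where

  open CompleteOrderedField ℝ hiding (zero)
  open SemiringSum semiring public
    using (sum; sum-cong-≋; sum-permute; ∑-distrib-+; *-distribˡ-sum; *-distribʳ-sum)
  open GroupProperties +-group using (//-rightDividesˡ; //-rightDividesʳ)
  open RingProperties ring using (-‿distribˡ-*; -‿distribʳ-*; -‿involutive)
  open CommutativeSemigroupProperties +-commutativeSemigroup using (xy∙z≈xz∙y; interchange)
  open SemiringSolver commutativeSemiring using (solve; _:+_; _:*_; _:=_)
  open IsTotalOrder isTotalOrder public using (total; antisym)
    renaming (refl to ≤-refl; trans to ≤-trans; reflexive to ≤-reflexive;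
              isPartialOrder to ≤-isPartialOrder)

  ≤-poset : Poset _ _ _
  ≤-poset = record { isPartialOrder = ≤-isPartialOrder }

  open PartialOrderReasoning ≤-poset

  +-monoʳ-≤ : ∀ z {x y} → x ≤ y → z + x ≤ z + y
  +-monoʳ-≤ z {x} {y} x≤y = begin
    z + x ≈⟨ +-comm z x ⟩
    x + z ≤⟨ +-monoˡ-≤ z x≤y ⟩
    y + z ≈⟨ +-comm y z ⟩
    z + y ∎

  +-mono-≤ : ∀ {x y u v} → x ≤ y → u ≤ v → x + u ≤ y + v
  +-mono-≤ {y = y} {u = u} x≤y u≤v = ≤-trans (+-monoˡ-≤ u x≤y) (+-monoʳ-≤ y u≤v)

  +-cancelʳ-≤ : ∀ z {x y} → x + z ≤ y + z → x ≤ y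
  +-cancelʳ-≤ z {x} {y} h = begin
    x         ≈⟨ //-rightDividesʳ z x ⟨
    x + z - z ≤⟨ +-monoˡ-≤ (- z) h ⟩
    y + z - z ≈⟨ //-rightDividesʳ z y ⟩
    y         ∎

  -- Together with `+-squeezeˡ-≤`: if two inequalities `c ≤ a` and `e ≤ b` add up to one that also
  -- holds in reverse, each of them is reversible.
  +-squeezeʳ-≤ : ∀ {a b c e} → a + b ≤ c + e → c ≤ a → b ≤ e
  +-squeezeʳ-≤ {a} {b} {c} {e} h c≤a = +-cancelʳ-≤ a (begin
    b + a ≈⟨ +-comm b a ⟩
    a + b ≤⟨ h ⟩
    c + e ≤⟨ +-monoˡ-≤ e c≤a ⟩
    a + e ≈⟨ +-comm a e ⟩
    e + a ∎)

  +-squeezeˡ-≤ : ∀ {a b c e} → a + b ≤ c + e → e ≤ b → a ≤ c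
  +-squeezeˡ-≤ {a} {b} {c} {e} h e≤b = +-cancelʳ-≤ b (≤-trans h (+-monoʳ-≤ c e≤b))

  [x-y]+[y+a]≈a+x : ∀ x y a → (x - y) + (y + a) ≈ a + x
  [x-y]+[y+a]≈a+x x y a =
    trans (sym (+-assoc _ y a)) (trans (+-congʳ (//-rightDividesˡ y x)) (+-comm x a))

  [b-a]+[y+a]≈b+y : ∀ b a y → (b - a) + (y + a) ≈ b + y
  [b-a]+[y+a]≈b+y b a y = trans (+-congˡ (+-comm y a)) (trans ([x-y]+[y+a]≈a+x b a y) (+-comm y b))

  x+[y-x]≈y : ∀ x y → x + (y - x) ≈ y
  x+[y-x]≈y x y = trans (+-comm x (y - x)) (trans (+-assoc y (- x) x)
    (trans (+-congˡ (-‿inverseˡ x)) (+-identityʳ y)))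

  x-y≤b-a⇒a+x≤b+y : ∀ {x y a b} → x - y ≤ b - a → a + x ≤ b + y
  x-y≤b-a⇒a+x≤b+y {x} {y} {a} {b} h = begin
    a + x             ≈⟨ [x-y]+[y+a]≈a+x x y a ⟨
    (x - y) + (y + a) ≤⟨ +-monoˡ-≤ (y + a) h ⟩
    (b - a) + (y + a) ≈⟨ [b-a]+[y+a]≈b+y b a y ⟩
    b + y             ∎

  a+x≤b+y⇒x-y≤b-a : ∀ {x y a b} → a + x ≤ b + y → x - y ≤ b - a
  a+x≤b+y⇒x-y≤b-a {x} {y} {a} {b} h = +-cancelʳ-≤ (y + a) (begin
    (x - y) + (y + a) ≈⟨ [x-y]+[y+a]≈a+x x y a ⟩
    a + x             ≤⟨ h ⟩
    b + y             ≈⟨ [b-a]+[y+a]≈b+y b a y ⟨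
    (b - a) + (y + a) ∎)

  x≤y⇒0≤y-x : ∀ {x y} → x ≤ y → 0# ≤ y - x
  x≤y⇒0≤y-x {x} {y} h = begin
    0#    ≈⟨ -‿inverseʳ x ⟨
    x - x ≤⟨ +-monoˡ-≤ (- x) h ⟩
    y - x ∎

  x≤0⇒0≤-x : ∀ {x} → x ≤ 0# → 0# ≤ - x
  x≤0⇒0≤-x {x} h = ≤-trans (x≤y⇒0≤y-x h) (≤-reflexive (+-identityˡ (- x)))

  *-monoˡ-≤ : ∀ {x y z} → 0# ≤ z → x ≤ y → z * x ≤ z * y
  *-monoˡ-≤ {x} {y} {z} 0≤z x≤y = +-cancelʳ-≤ (- (z * x)) (begin
    z * x - z * x     ≈⟨ -‿inverseʳ (z * x) ⟩
    0#                ≤⟨ *-nonneg 0≤z (x≤y⇒0≤y-x x≤y) ⟩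
    z * (y - x)       ≈⟨ distribˡ z y (- x) ⟩
    z * y + z * - x   ≈⟨ +-congˡ (-‿distribʳ-* z x) ⟨
    z * y - z * x     ∎)

  0≤1 : 0# ≤ 1#
  0≤1 = [ (λ h → h) , (λ h → begin
      0#          ≤⟨ *-nonneg (x≤0⇒0≤-x h) (x≤0⇒0≤-x h) ⟩
      - 1# * - 1# ≈⟨ -‿distribˡ-* 1# (- 1#) ⟨
      - (1# * - 1#) ≈⟨ -‿cong (*-identityˡ (- 1#)) ⟩
      - - 1#      ≈⟨ -‿involutive 1# ⟩
      1#          ∎) ]′ (total 0# 1#)

  -- The axioms supply only `≤`; by totality and antisymmetry this negation is strict positivity.
  Positive : Carrier → Set
  Positive x = ¬ x ≤ 0#

  positive⇒0≤ : ∀ {x} → Positive x → 0# ≤ x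
  positive⇒0≤ {x} x>0 = [ (λ h → h) , (λ h → ⊥-elim (x>0 h)) ]′ (total 0# x)

  1-positive : Positive 1#
  1-positive h = 1≉0 (antisym h 0≤1)

  positive-≤ : ∀ {x y} → Positive x → x ≤ y → Positive y
  positive-≤ x>0 x≤y y≤0 = x>0 (≤-trans x≤y y≤0)

  1+-positive : ∀ {x} → 0# ≤ x → Positive (x + 1#)
  1+-positive {x} 0≤x = positive-≤ 1-positive (begin
    1#      ≈⟨ +-identityˡ 1# ⟨
    0# + 1# ≤⟨ +-monoˡ-≤ 1# 0≤x ⟩
    x + 1#  ∎)

  positive-inverse : ∀ {x} → Positive x → ∃[ y ] Positive y × x * y ≈ 1#
  positive-inverse {x} x>0 with inverse x (λ x≈0 → x>0 (≤-reflexive x≈0))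
  ... | y , xy≈1 = y , (λ y≤0 → 1-positive (begin
      1#    ≈⟨ xy≈1 ⟨
      x * y ≤⟨ *-monoˡ-≤ (positive⇒0≤ x>0) y≤0 ⟩
      x * 0# ≈⟨ zeroʳ x ⟩
      0#    ∎)) , xy≈1

  *-positive : ∀ {x y} → Positive x → Positive y → Positive (x * y)
  *-positive {x} {y} x>0 y>0 xy≤0 with positive-inverse x>0
  ... | x′ , x′>0 , xx′≈1 = y>0 (begin
      y            ≈⟨ *-identityˡ y ⟨
      1# * y       ≈⟨ *-congʳ xx′≈1 ⟨
      (x * x′) * y ≈⟨ solve 3 (λ a b c → (a :* b) :* c := b :* (a :* c)) refl x x′ y ⟩
      x′ * (x * y) ≤⟨ *-monoˡ-≤ (positive⇒0≤ x′>0) xy≤0 ⟩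
      x′ * 0#      ≈⟨ zeroʳ x′ ⟩
      0#           ∎)

  halves : ∃[ h ] Positive h × h + h ≈ 1#
  halves with positive-inverse (1+-positive 0≤1)
  ... | h , h>0 , 2h≈1 = h , h>0 , (begin-equality
    h + h             ≈⟨ +-cong (*-identityˡ h) (*-identityˡ h) ⟨
    1# * h + 1# * h   ≈⟨ distribʳ h 1# 1# ⟨
    (1# + 1#) * h     ≈⟨ 2h≈1 ⟩
    1#                ∎)

  module Midpoint (h : Carrier) (h>0 : Positive h) (h+h≈1 : h + h ≈ 1#) where

    h*x+h*x≈x : ∀ x → h * x + h * x ≈ x
    h*x+h*x≈x x = trans (sym (distribʳ x h h)) (trans (*-congʳ h+h≈1) (*-identityˡ x))

    *-cancelˡ-≤ : ∀ {x y} → h * x ≤ h * y → x ≤ y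
    *-cancelˡ-≤ {x} {y} le = begin
      x             ≈⟨ h*x+h*x≈x x ⟨
      h * x + h * x ≤⟨ +-mono-≤ le le ⟩
      h * y + h * y ≈⟨ h*x+h*x≈x y ⟩
      y             ∎

    a+h*[x+y]≈h*[[a+x]+[a+y]] : ∀ a x y → a + h * (x + y) ≈ h * ((a + x) + (a + y))
    a+h*[x+y]≈h*[[a+x]+[a+y]] a x y = begin-equality
      a + h * (x + y)               ≈⟨ +-congʳ (h*x+h*x≈x a) ⟨
      (h * a + h * a) + h * (x + y) ≈⟨ +-congʳ (distribˡ h a a) ⟨
      h * (a + a) + h * (x + y)     ≈⟨ distribˡ h (a + a) (x + y) ⟨
      h * ((a + a) + (x + y))       ≈⟨ *-congˡ (interchange a a x y) ⟩
      h * ((a + x) + (a + y))       ∎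

  abstract
    -- Splits a weighted simplex vertex into the base vertex and the displacement along one axis.
    simplex-split : ∀ c z e r s → c * (z + e * (r + s)) ≈ c * (z + e * r) + e * (c * s)
    simplex-split = solve 5 (λ c z e r s →
      c :* (z :+ e :* (r :+ s)) := c :* (z :+ e :* r) :+ e :* (c :* s)) refl

  sum-zero : ∀ {k} {f : Vector Carrier k} → (∀ i → f i ≈ 0#) → sum f ≈ 0#
  sum-zero {zero}  f≈0 = refl
  sum-zero {suc k} f≈0 = trans (+-cong (f≈0 zero) (sum-zero (λ i → f≈0 (suc i)))) (+-identityˡ 0#)

  sum-mono-≤ : ∀ {k} {f g : Vector Carrier k} → (∀ i → f i ≤ g i) → sum f ≤ sum g
  sum-mono-≤ {zero}  f≤g = ≤-refl
  sum-mono-≤ {suc k} f≤g = +-mono-≤ (f≤g zero) (sum-mono-≤ (λ i → f≤g (suc i)))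

  sum-0≤ : ∀ {k} {g : Vector Carrier k} → (∀ i → 0# ≤ g i) → 0# ≤ sum g
  sum-0≤ {k} {g} h = begin
    0#                       ≈⟨ sum-zero {k} {λ _ → 0#} (λ _ → refl) ⟨
    sum {k} (λ _ → 0#)       ≤⟨ sum-mono-≤ h ⟩
    sum g                    ∎

  sum+1≤sum : ∀ {k} {f g : Vector Carrier k} → (∀ i → f i ≤ g i) →
              ∀ i → f i + 1# ≤ g i → sum f + 1# ≤ sum g
  sum+1≤sum {f = f} {g} f≤g zero h = begin
    f zero + sum f′ + 1#   ≈⟨ xy∙z≈xz∙y (f zero) (sum f′) 1# ⟩
    f zero + 1# + sum f′   ≤⟨ +-mono-≤ h (sum-mono-≤ (λ i → f≤g (suc i))) ⟩
    sum g                  ∎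
    where f′ = λ i → f (suc i)
  sum+1≤sum {f = f} {g} f≤g (suc i) h = begin
    f zero + sum f′ + 1#   ≈⟨ +-assoc _ _ _ ⟩
    f zero + (sum f′ + 1#) ≤⟨ +-mono-≤ (f≤g zero) (sum+1≤sum (λ i → f≤g (suc i)) i h) ⟩
    sum g                  ∎
    where f′ = λ i → f (suc i)

  -- The minimum of finitely many positive thresholds works for all of them, because every `Q i` is
  -- closed downwards.
  common-positive : ∀ {N} (Q : Fin N → Pred Carrier 0ℓ) →
    (∀ i {x y} → x ≤ y → y ∈ Q i → x ∈ Q i) →
    (∀ i → ∃[ x ] Positive x × x ∈ Q i) → ∃[ x ] Positive x × (∀ i → x ∈ Q i)
  common-positive {zero}  Q down pos = 1# , 1-positive , λ ()
  common-positive {suc N} Q down pos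
    with pos zero | common-positive (λ i → Q (suc i)) (λ i → down (suc i)) (λ i → pos (suc i))
  ... | x , x>0 , x∈Q | y , y>0 , y∈Q with total x y
  ...   | inj₁ x≤y = x , x>0 , λ { zero → x∈Q ; (suc i) → down (suc i) x≤y (y∈Q i) }
  ...   | inj₂ y≤x = y , y>0 , λ { zero → down zero y≤x x∈Q ; (suc i) → y∈Q i }

  indicator : {P : Set} → Dec P → Carrier
  indicator (yes _) = 1#
  indicator (no _)  = 0#

  indicator-mono : {P Q : Set} (p : Dec P) (q : Dec Q) → (P → Q) → indicator p ≤ indicator q
  indicator-mono (yes p) (yes q) _   = ≤-refl
  indicator-mono (yes p) (no ¬q) p⇒q = ⊥-elim (¬q (p⇒q p))
  indicator-mono (no ¬p) (yes q) _   = 0≤1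
  indicator-mono (no ¬p) (no ¬q) _   = ≤-refl

  indicator-strict : {P Q : Set} (p : Dec P) (q : Dec Q) → ¬ P → Q → indicator p + 1# ≤ indicator q
  indicator-strict (yes p) _       ¬p _ = ⊥-elim (¬p p)
  indicator-strict (no _)  (yes _) _  _ = ≤-reflexive (+-identityˡ 1#)
  indicator-strict (no _)  (no ¬q) _  q = ⊥-elim (¬q q)

  0≤indicator : {P : Set} (p : Dec P) → 0# ≤ indicator p
  0≤indicator (yes _) = 0≤1
  0≤indicator (no _)  = ≤-refl

  indicator≤1 : {P : Set} (p : Dec P) → indicator p ≤ 1#
  indicator≤1 (yes _) = ≤-refl
  indicator≤1 (no _)  = 0≤1

  δ : ∀ {k} → Fin k → Fin k → Carrier
  δ zero    zero    = 1#
  δ zero    (suc l) = 0#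
  δ (suc i) zero    = 0#
  δ (suc i) (suc l) = δ i l

  0≤δ : ∀ {k} (i l : Fin k) → 0# ≤ δ i l
  0≤δ zero    zero    = 0≤1
  0≤δ zero    (suc l) = ≤-refl
  0≤δ (suc i) zero    = ≤-refl
  0≤δ (suc i) (suc l) = 0≤δ i l

  δ≤1 : ∀ {k} (i l : Fin k) → δ i l ≤ 1#
  δ≤1 zero    zero    = ≤-refl
  δ≤1 zero    (suc l) = 0≤1
  δ≤1 (suc i) zero    = 0≤1
  δ≤1 (suc i) (suc l) = δ≤1 i l

  sum-*-δ : ∀ {k} (c : Vector Carrier k) l → sum (λ i → c i * δ i l) ≈ c l
  sum-*-δ c zero = trans
    (+-cong (*-identityʳ (c zero)) (sum-zero (λ i → zeroʳ (c (suc i))))) (+-identityʳ (c zero))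
  sum-*-δ c (suc l) = trans
    (+-cong (zeroʳ (c zero)) (sum-*-δ (λ i → c (suc i)) l)) (+-identityˡ (c (suc l)))

-- Sectors of a tropically generic matrix with finite entries `v`.

module Covectors (em : ExcludedMiddle 0ℓ) (ℝ : CompleteOrderedField) {d n : ℕ}
  (V : Tropical.Matrix ℝ d n)
  (v : Fin d → Fin n → CompleteOrderedField.Carrier ℝ) (V≡v : ∀ i j → V i j ≡ [ v i j ])
  (generic : Tropical.TropicallyGeneric ℝ V) where

  open CompleteOrderedField ℝ hiding (zero)
  open OrderedFieldProperties ℝ
  open Tropical ℝ hiding (sum)
  open PartialOrderReasoning ≤-poset
  open CommutativeSemigroupProperties +-commutativeSemigroup using (interchange)
  module *-Properties = CommutativeSemigroupProperties *-commutativeSemigroup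

  -- Membership in a sector, with both sides moved so that no subtraction occurs.
  Attains : Point d → Fin d → Fin n → Set
  Attains z i j = ∀ l → v i j + z l ≤ v l j + z i

  sector⇒attains : ∀ {z i j} → z ∈ Sector (column V j) i → Attains z i j
  sector⇒attains {i = i} {j} (a , eq , h) l with ≡.trans (≡.sym eq) (V≡v i j)
  ... | ≡.refl = x-y≤b-a⇒a+x≤b+y (h l (v l j) (V≡v l j))

  attains⇒sector : ∀ {z i j} → Attains z i j → z ∈ Sector (column V j) i
  attains⇒sector {z} {i} {j} h = v i j , V≡v i j , bound
    where
    bound : ∀ l b → V l j ≡ [ b ] → z l - z i ≤ b - v i j
    bound l b eq with ≡.trans (≡.sym (V≡v l j)) eq
    ... | ≡.refl = a+x≤b+y⇒x-y≤b-a (h l)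

  -- `Attains z m j` says that row `m` minimises `v l j - z l` over `l`; a row doing at least as
  -- well as a minimiser is a minimiser too.
  attains-transfer : ∀ {z i m j} → Attains z m j → v i j + z m ≤ v m j + z i → Attains z i j
  attains-transfer {z} {i} {m} {j} hm h l = +-cancelʳ-≤ (z m + v m j) (begin
    (v i j + z l) + (z m + v m j) ≈⟨ lemma (v i j) (z l) (z m) (v m j) ⟩
    (v i j + z m) + (v m j + z l) ≤⟨ +-mono-≤ h (hm l) ⟩
    (v m j + z i) + (v l j + z m) ≈⟨ lemma′ (v m j) (z i) (v l j) (z m) ⟩
    (v l j + z i) + (z m + v m j) ∎)
    where
    lemma : ∀ a b c e → (a + b) + (c + e) ≈ (a + c) + (e + b)
    lemma a b c e = trans (interchange a b c e) (+-congˡ (+-comm b e))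
    lemma′ : ∀ a b c e → (a + b) + (c + e) ≈ (c + b) + (e + a)
    lemma′ a b c e = trans (+-comm _ _) (trans (lemma c e a b) (trans (interchange c a b e)
      (+-congˡ (+-comm a e))))

  -- Terms of the tropical determinant as weights of matchings.

  sum⁺-finite : ∀ {k} {t : Vector 𝕋 k} {s : Vector Carrier k} →
                (∀ i → t i ≡ [ s i ]) → sum⁺ t ≡ [ sum s ]
  sum⁺-finite {zero}  t≡s = ≡.refl
  sum⁺-finite {suc k} t≡s = ≡.cong₂ (zipWith _+_) (t≡s zero) (sum⁺-finite (λ i → t≡s (suc i)))

  module _ {k} (r : Fin k → Fin d) (c : Fin k → Fin n) where

    matching : Permutation′ k → Carrier
    matching σ = sum (λ a → v (r a) (c (σ ⟨$⟩ʳ a)))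

    minor : Matrix k k
    minor a b = V (r a) (c b)

    weight≡matching : ∀ σ → weight minor σ ≡ [ matching σ ]
    weight≡matching σ = sum⁺-finite (λ a → V≡v (r a) (c (σ ⟨$⟩ʳ a)))

    -- Lists the edges of a matching by columns instead of rows, so that two matchings can be
    -- compared column by column.
    sum-reindex : ∀ (g : Fin k → Fin k → Carrier) (σ : Permutation′ k) →
                  sum (λ b → g (σ ⟨$⟩ˡ b) b) ≈ sum (λ a → g a (σ ⟨$⟩ʳ a))
    sum-reindex g σ = trans (sum-permute (λ b → g (σ ⟨$⟩ˡ b) b) σ)
      (sum-cong-≋ (λ a → reflexive (≡.cong (λ x → g x (σ ⟨$⟩ʳ a)) (inverseˡ σ))))

    Matches : Point d → Permutation′ k → Set
    Matches z σ = ∀ a → Attains z (r a) (c (σ ⟨$⟩ʳ a))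

    -- Linear programming duality for the assignment problem: `z` acts as a potential, and in each
    -- column the row chosen by `σ` has least reduced cost. Summed over the columns, the potentials
    -- contribute equally to both sides.
    matches⇒minimal : ∀ {z σ} → Matches z σ → ∀ π → matching σ ≤ matching π
    matches⇒minimal {z} {σ} h π = +-cancelʳ-≤ (sum (λ a → z (r a))) (begin
      -- The potentials are reindexed along `π` here and along `σ` at the end, which makes the
      -- summands of column `b` the inequality of `Attains` at the row that `π` chooses.
      matching σ + sum (λ a → z (r a))
        ≈⟨ +-cong (sum-reindex (λ a b → v (r a) (c b)) σ) (sum-reindex (λ a _ → z (r a)) π) ⟨
      sum (λ b → v (r (σ ⟨$⟩ˡ b)) (c b)) + sum (λ b → z (r (π ⟨$⟩ˡ b)))
        ≈⟨ ∑-distrib-+ (λ b → v (r (σ ⟨$⟩ˡ b)) (c b)) (λ b → z (r (π ⟨$⟩ˡ b))) ⟨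
      sum (λ b → v (r (σ ⟨$⟩ˡ b)) (c b) + z (r (π ⟨$⟩ˡ b)))
        ≤⟨ sum-mono-≤ (λ b → at b (r (π ⟨$⟩ˡ b))) ⟩
      sum (λ b → v (r (π ⟨$⟩ˡ b)) (c b) + z (r (σ ⟨$⟩ˡ b)))
        ≈⟨ ∑-distrib-+ (λ b → v (r (π ⟨$⟩ˡ b)) (c b)) (λ b → z (r (σ ⟨$⟩ˡ b))) ⟩
      sum (λ b → v (r (π ⟨$⟩ˡ b)) (c b)) + sum (λ b → z (r (σ ⟨$⟩ˡ b)))
        ≈⟨ +-cong (sum-reindex (λ a b → v (r a) (c b)) π) (sum-reindex (λ a _ → z (r a)) σ) ⟩
      matching π + sum (λ a → z (r a)) ∎)
      where
      at : ∀ b → Attains z (r (σ ⟨$⟩ˡ b)) (c b)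
      at b = ≡.subst (λ x → Attains z (r (σ ⟨$⟩ˡ b)) (c x)) (inverseʳ σ) (h (σ ⟨$⟩ˡ b))

    -- Two matchings supported at the same point are both minimal, so if they differed the tropical
    -- determinant of the minor would vanish.
    matchings-unique : Injective _≡_ _≡_ r → Injective _≡_ _≡_ c →
      ∀ z σ τ → Matches z σ → Matches z τ → ¬ ¬ σ ≈ₚ τ
    matchings-unique r-inj c-inj z σ τ hσ hτ σ≉τ = generic k r c r-inj c-inj
      ( weight minor σ
      , ( (λ π → ≡.subst₂ _≤⁺_ (≡.sym (weight≡matching σ)) (≡.sym (weight≡matching π))
                   NonStrict.[ matches⇒minimal {z} {σ} hσ π ])
        , σ , equal {σ} refl )
      , inj₂ (σ , τ , σ≉τ , equal {σ} refl ,
        equal {τ} (antisym (matches⇒minimal {z} {τ} hτ σ) (matches⇒minimal {z} {σ} hσ τ))))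
      where
      equal : ∀ {π} → matching π ≈ matching σ → weight minor π ≈⁺ weight minor σ
      equal {π} eq = ≡.subst₂ _≈⁺_ (≡.sym (weight≡matching π)) (≡.sym (weight≡matching σ)) Equality.[ eq ]

  -- Moving a point into the interior of its chosen sectors.

  module Perturbation (z : Point d) (f : Fin n → Fin d) (f-attains : ∀ j → Attains z (f j) j) where

    -- These are the tight inequalities at `z`: a move by `u` can stay in all chosen sectors only if
    -- `u l ≤ u m` whenever `l ≺ m`.
    _≺_ : Rel (Fin d) 0ℓ
    l ≺ m = ∃[ j ] f j ≡ m × ¬ l ≡ m × Attains z l j

    -- The rows are the vertices of the cycle and the columns come from its edges. Each edge column
    -- is attained at its tail, giving the identity matching, and at its head, which `f` selects,
    -- giving the backward shift.
    no-simpleWalk : ∀ {k} (w : ClosedWalk _≺_ k) → ¬ Simple _≺_ w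
    no-simpleWalk {k} w simple = matchings-unique r c r-injective c-injective
      z σ Permutation.id σ-matches (λ a → proj₂ (proj₂ (proj₂ (edge′ a)))) σ≉id
      where
      open ClosedWalk w
      σ : Permutation′ (suc k)
      σ = backwardShift k
      edge′ : ∀ (a : Fin (suc k)) → vertex (toℕ a) ≺ vertex (suc (toℕ a))
      edge′ a = edge (toℕ a) (Fin.toℕ<n a)
      r : Fin (suc k) → Fin d
      r a = vertex (toℕ a)
      c : Fin (suc k) → Fin n
      c a = proj₁ (edge′ a)
      f∘c : ∀ a → f (c a) ≡ vertex (suc (toℕ a))
      f∘c a = proj₁ (proj₂ (edge′ a))
      f∘c∘σ : ∀ a → f (c (σ ⟨$⟩ʳ a)) ≡ r a
      -- The wrap-around: row `zero` is paired with the column of the last edge, whose head is the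
      -- start of the walk.
      f∘c∘σ zero = ≡.trans (f∘c (fromℕ k))
        (≡.trans (≡.cong (λ t → vertex (suc t)) (Fin.toℕ-fromℕ k)) closed)
      f∘c∘σ (suc i) = ≡.trans (f∘c (punchIn (fromℕ k) i))
        (≡.cong (λ t → vertex (suc t)) (toℕ-punchIn-fromℕ k i))
      r-injective : Injective _≡_ _≡_ r
      r-injective {a} {b} eq =
        Fin.toℕ-injective (simple (toℕ a) (toℕ b) (Fin.toℕ<n a) (Fin.toℕ<n b) eq)
      c-injective : Injective _≡_ _≡_ c
      -- A column determines its head through `f`, and the heads are the distinct vertices in
      -- shifted order.
      c-injective {a} {b} eq = ≡.trans (≡.sym (inverseʳ σ)) (≡.trans (≡.cong (σ ⟨$⟩ʳ_)
        (r-injective (≡.trans (≡.sym (at a)) (≡.trans (≡.cong f eq) (at b))))) (inverseʳ σ))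
        where
        at : ∀ x → f (c x) ≡ r (σ ⟨$⟩ˡ x)
        at x = ≡.trans (≡.cong (λ y → f (c y)) (≡.sym (inverseʳ σ))) (f∘c∘σ (σ ⟨$⟩ˡ x))
      σ-matches : Matches r c z σ
      σ-matches a = ≡.subst (λ i → Attains z i (c (σ ⟨$⟩ʳ a))) (f∘c∘σ a) (f-attains (c (σ ⟨$⟩ʳ a)))
      σ≉id : ¬ σ ≈ₚ Permutation.id
      -- Were the shift to fix `zero`, the first edge would have equal tail and head, which `≺`
      -- excludes.
      σ≉id eq = proj₁ (proj₂ (proj₂ (edge′ zero)))
        (≡.trans (≡.sym (f∘c∘σ zero)) (≡.trans (≡.cong (λ y → f (c y)) (eq zero)) (f∘c zero)))

    acyclic : ∀ x → ¬ TransClosure _≺_ x x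
    acyclic x x≺⁺x with ⁺⇒closedWalk _≺_ x≺⁺x
    ... | k , w with simpleWalk _≺_ em k w
    ...   | _ , w′ , simple = no-simpleWalk w′ simple

    below : Fin d → Fin d → Carrier
    below x l = indicator (em {TransClosure _≺_ x l})

    rank : Fin d → Carrier
    rank l = sum (λ x → below x l)

    -- Everything below `l` is below `m`, while `l` itself is counted for `m` and, by acyclicity,
    -- not for `l`.
    rank-strict : ∀ {l m} → l ≺ m → rank l + 1# ≤ rank m
    rank-strict {l} {m} l≺m = sum+1≤sum {d}
      (λ x → indicator-mono em em (λ x≺⁺l → x≺⁺l ++ [ l≺m ]))
      l (indicator-strict em em (acyclic l) [ l≺m ])

    0≤rank : ∀ l → 0# ≤ rank l
    0≤rank l = sum-0≤ {d} (λ x → 0≤indicator em)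

    -- The field element `d + 1`: a rank is at most `d`, and the simplex vertices add at most one to
    -- it.
    maxShift : Carrier
    maxShift = sum {d} (λ _ → 1#) + 1#

    maxShift-positive : Positive maxShift
    maxShift-positive = 1+-positive (sum-0≤ {d} (λ _ → 0≤1))

    rank+1≤maxShift : ∀ l → rank l + 1# ≤ maxShift
    rank+1≤maxShift l = +-monoˡ-≤ 1# (sum-mono-≤ {d} (λ x → indicator≤1 em))

    -- A step length at which an inequality that is slack at `z` survives the largest displacement.
    Small : Carrier → Fin n → Fin d → Set
    Small ε j l = ¬ Attains z l j → v (f j) j + z l + ε * maxShift ≤ v l j + z (f j)

    Admissible : Point d → Set
    Admissible u = (∀ l → 0# ≤ u l) × (∀ l → u l ≤ maxShift) × (∀ {l m} → l ≺ m → u l ≤ u m)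

    -- Tight inequalities survive because `u` is monotone along `≺`, slack ones because the step is
    -- small.
    attains-perturbed : ∀ {ε u} → Positive ε → (∀ j l → Small ε j l) → Admissible u →
                        ∀ j → Attains (λ l → z l + ε * u l) (f j) j
    attains-perturbed {ε} {u} ε>0 small (u≥0 , u≤M , mono) j l with em {l ≡ f j} | em {Attains z l j}
    ... | yes ≡.refl | _ = ≤-refl
    ... | no l≢fj | yes l-attains = begin
      v (f j) j + (z l + ε * u l)       ≈⟨ +-assoc _ _ _ ⟨
      v (f j) j + z l + ε * u l         ≤⟨ +-mono-≤ (f-attains j l)
        (*-monoˡ-≤ (positive⇒0≤ ε>0) (mono (j , ≡.refl , l≢fj , l-attains))) ⟩
      v l j + z (f j) + ε * u (f j)     ≈⟨ +-assoc _ _ _ ⟩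
      v l j + (z (f j) + ε * u (f j))   ∎
    ... | no _ | no ¬attains = begin
      v (f j) j + (z l + ε * u l)       ≈⟨ +-assoc _ _ _ ⟨
      v (f j) j + z l + ε * u l         ≤⟨ +-monoʳ-≤ _ (*-monoˡ-≤ (positive⇒0≤ ε>0) (u≤M l)) ⟩
      v (f j) j + z l + ε * maxShift    ≤⟨ small j l ¬attains ⟩
      v l j + z (f j)                   ≈⟨ +-identityʳ _ ⟨
      v l j + z (f j) + 0#              ≤⟨ +-monoʳ-≤ _ (*-nonneg (positive⇒0≤ ε>0) (u≥0 (f j))) ⟩
      v l j + z (f j) + ε * u (f j)     ≈⟨ +-assoc _ _ _ ⟩
      v l j + (z (f j) + ε * u (f j))   ∎

    small-mono : ∀ {j l x y} → x ≤ y → Small y j l → Small x j l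
    small-mono {j} {l} {x} {y} x≤y h ¬a = ≤-trans (+-monoʳ-≤ _ (begin
      x * maxShift ≈⟨ *-comm x maxShift ⟩
      maxShift * x ≤⟨ *-monoˡ-≤ (positive⇒0≤ maxShift-positive) x≤y ⟩
      maxShift * y ≈⟨ *-comm maxShift y ⟩
      y * maxShift ∎)) (h ¬a)

    exists-small₁ : ∀ j l → ∃[ ε ] Positive ε × Small ε j l
    exists-small₁ j l with em {Attains z l j}
    ... | yes a = 1# , 1-positive , λ ¬a → ⊥-elim (¬a a)
    ... | no ¬a with positive-inverse maxShift-positive
    ...   | M⁻¹ , M⁻¹>0 , MM⁻¹≈1 =
      -- The slack divided by `maxShift` is the extreme choice, turning the required inequality into
      -- an equality.
      gap * M⁻¹ , *-positive gap-positive M⁻¹>0 , λ _ → ≤-reflexive (begin-equality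
        a₀ + gap * M⁻¹ * maxShift   ≈⟨ +-congˡ (*-assoc gap M⁻¹ maxShift) ⟩
        a₀ + gap * (M⁻¹ * maxShift) ≈⟨ +-congˡ (*-congˡ (trans (*-comm M⁻¹ maxShift) MM⁻¹≈1)) ⟩
        a₀ + gap * 1#               ≈⟨ +-congˡ (*-identityʳ gap) ⟩
        a₀ + gap                    ≈⟨ x+[y-x]≈y a₀ b₀ ⟩
        b₀                          ∎)
      where
      a₀ b₀ gap : Carrier
      a₀ = v (f j) j + z l
      b₀ = v l j + z (f j)
      gap = b₀ - a₀
      gap-positive : Positive gap
      gap-positive gap≤0 = ¬a (attains-transfer (f-attains j) (begin
        b₀          ≈⟨ x+[y-x]≈y a₀ b₀ ⟨
        a₀ + gap    ≤⟨ +-monoʳ-≤ a₀ gap≤0 ⟩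
        a₀ + 0#     ≈⟨ +-identityʳ a₀ ⟩
        a₀          ∎))

    exists-small : ∃[ ε ] Positive ε × (∀ j l → Small ε j l)
    exists-small = common-positive (λ j ε → ∀ l → Small ε j l)
      (λ j x≤y h l → small-mono x≤y (h l))
      (λ j → common-positive (λ l ε → Small ε j l) (λ l → small-mono) (exists-small₁ j))

    -- A full-dimensional simplex inside the cell.

    shift : Fin (suc d) → Point d
    shift zero    l = rank l
    shift (suc x) l = rank l + δ x l

    -- Ranks rise by at least one along `≺`, which leaves room to add a unit vector without breaking
    -- monotonicity.
    admissible : ∀ m → Admissible (shift m)
    admissible zero = 0≤rank , (λ l → ≤-trans (rank≤rank+1 l) (rank+1≤maxShift l)) ,
                      (λ {l} l≺m → ≤-trans (rank≤rank+1 l) (rank-strict l≺m))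
      where
      rank≤rank+1 : ∀ l → rank l ≤ rank l + 1#
      rank≤rank+1 l = ≤-trans (≤-reflexive (sym (+-identityʳ (rank l)))) (+-monoʳ-≤ (rank l) 0≤1)
    admissible (suc x) = (λ l → ≤-trans (0≤rank l) (rank≤shift l)) ,
                         (λ l → ≤-trans (shift≤rank+1 l) (rank+1≤maxShift l)) ,
                         (λ {l} {m} l≺m → ≤-trans (shift≤rank+1 l)
                           (≤-trans (rank-strict l≺m) (rank≤shift m)))
      where
      rank≤shift : ∀ l → rank l ≤ shift (suc x) l
      rank≤shift l = ≤-trans (≤-reflexive (sym (+-identityʳ (rank l)))) (+-monoʳ-≤ (rank l) (0≤δ x l))
      shift≤rank+1 : ∀ l → shift (suc x) l ≤ rank l + 1#
      shift≤rank+1 l = +-monoʳ-≤ (rank l) (δ≤1 x l)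

    cell : Pred (Point d) 0ℓ
    cell y = ∀ j → y ∈ Sector (column V j) (f j)

    module _ (ε ε⁻¹ : Carrier) (εε⁻¹≈1 : ε * ε⁻¹ ≈ 1#) where

      simplex : Fin (suc d) → Point d
      simplex m l = z l + ε * shift m l

      -- Vertex `suc x` is the base vertex moved by `ε` along axis `x`, so once `sum c` is known,
      -- coordinate `l` reveals the coefficient `c (suc l)`.
      combination≈ : ∀ c l → combination c simplex l ≈ sum c * simplex zero l + ε * c (suc l)
      combination≈ c l = begin-equality
        c zero * q + sum (λ x → c (suc x) * simplex (suc x) l)
          ≈⟨ +-congˡ (sum-cong-≋ (λ x → simplex-split (c (suc x)) (z l) ε (rank l) (δ x l))) ⟩
        c zero * q + sum (λ x → c (suc x) * q + ε * (c (suc x) * δ x l))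
          ≈⟨ +-congˡ (∑-distrib-+ (λ x → c (suc x) * q) (λ x → ε * (c (suc x) * δ x l))) ⟩
        c zero * q + (sum (λ x → c (suc x) * q) + sum (λ x → ε * (c (suc x) * δ x l)))
          ≈⟨ +-congˡ (+-cong (*-distribʳ-sum q c′) (*-distribˡ-sum ε (λ x → c′ x * δ x l))) ⟨
        c zero * q + (sum c′ * q + ε * sum (λ x → c′ x * δ x l))
          ≈⟨ +-assoc _ _ _ ⟨
        c zero * q + sum c′ * q + ε * sum (λ x → c′ x * δ x l)
          ≈⟨ +-cong (sym (distribʳ q (c zero) (sum c′))) (*-congˡ (sum-*-δ c′ l)) ⟩
        sum c * q + ε * c (suc l) ∎
        where
        q : Carrier
        q = simplex zero l
        c′ : Vector Carrier d
        c′ x = c (suc x)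

      combination-zero : ∀ c → sum c ≈ 0# → ∀ l → combination c simplex l ≈ ε * c (suc l)
      combination-zero c Σc≈0 l = trans (combination≈ c l)
        (trans (+-congʳ (trans (*-congʳ Σc≈0) (zeroˡ _))) (+-identityˡ _))

      ε⁻¹ε : ∀ x → ε * (ε⁻¹ * x) ≈ x
      ε⁻¹ε x = trans (sym (*-assoc ε ε⁻¹ x)) (trans (*-congʳ εε⁻¹≈1) (*-identityˡ x))

      simplex-independent : AffinelyIndependent simplex
      simplex-independent c Σc≈0 comb≈0 = coefficient
        where
        rest : ∀ l → c (suc l) ≈ 0#
        rest l = begin-equality
          c (suc l)               ≈⟨ ε⁻¹ε (c (suc l)) ⟨
          ε * (ε⁻¹ * c (suc l))   ≈⟨ *-Properties.x∙yz≈y∙xz ε ε⁻¹ (c (suc l)) ⟩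
          ε⁻¹ * (ε * c (suc l))   ≈⟨ *-congˡ (trans (sym (combination-zero c Σc≈0 l)) (comb≈0 l)) ⟩
          ε⁻¹ * 0#                ≈⟨ zeroʳ ε⁻¹ ⟩
          0#                      ∎
        coefficient : ∀ m → c m ≈ 0#
        coefficient zero = trans (sym (trans (+-congˡ (sum-zero rest)) (+-identityʳ (c zero)))) Σc≈0
        coefficient (suc l) = rest l

      -- The coefficients are the barycentric coordinates of `y`: its offset from the base vertex
      -- divided by `ε`, with the zeroth one chosen to make the sum `1#`.
      simplex-spans : ∀ y → AffineSpan simplex y
      simplex-spans y = c , Σc≈1 , λ l → sym (begin-equality
        combination c simplex l                     ≈⟨ combination≈ c l ⟩
        sum c * simplex zero l + ε * c (suc l)      ≈⟨ +-cong (trans (*-congʳ Σc≈1) (*-identityˡ _)) (ε⁻¹ε _) ⟩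
        simplex zero l + (y l - simplex zero l)     ≈⟨ x+[y-x]≈y (simplex zero l) (y l) ⟩
        y l                                         ∎)
        where
        c′ : Vector Carrier d
        c′ l = ε⁻¹ * (y l - simplex zero l)
        c : Vector Carrier (suc d)
        c zero    = 1# - sum c′
        c (suc l) = c′ l
        Σc≈1 : sum c ≈ 1#
        Σc≈1 = trans (+-comm (1# - sum c′) (sum c′)) (x+[y-x]≈y (sum c′) 1#)

    hasDimension : ∀ {C : Pred (Point d) 0ℓ} → cell ⊆ C → HasDimension C d
    hasDimension cell⊆C with exists-small
    ... | ε , ε>0 , small with positive-inverse ε>0
    ...   | ε⁻¹ , _ , εε⁻¹≈1 =
      simplex ε ε⁻¹ εε⁻¹≈1 ,
      (λ m → cell⊆C (λ j → attains⇒sector (attains-perturbed ε>0 small (admissible m) j))) ,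
      simplex-independent ε ε⁻¹ εε⁻¹≈1 , λ {y} _ → simplex-spans ε ε⁻¹ εε⁻¹≈1 y

  -- Midpoints, generic points of cells, and maximal cells.

  open Midpoint (proj₁ halves) (proj₁ (proj₂ halves)) (proj₂ (proj₂ halves))

  midpoint : Point d → Point d → Point d
  midpoint y z l = proj₁ halves * (y l + z l)

  midpoint-attains : ∀ {y z i j} → Attains y i j → Attains z i j → Attains (midpoint y z) i j
  midpoint-attains {y} {z} {i} {j} hy hz l = begin
    v i j + midpoint y z l                          ≈⟨ a+h*[x+y]≈h*[[a+x]+[a+y]] (v i j) (y l) (z l) ⟩
    proj₁ halves * ((v i j + y l) + (v i j + z l))  ≤⟨ *-monoˡ-≤ (positive⇒0≤ (proj₁ (proj₂ halves)))
                                                         (+-mono-≤ (hy l) (hz l)) ⟩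
    proj₁ halves * ((v l j + y i) + (v l j + z i))  ≈⟨ a+h*[x+y]≈h*[[a+x]+[a+y]] (v l j) (y i) (z i) ⟨
    v l j + midpoint y z i                          ∎

  -- Sector `i` meets sector `m` in a face of the latter. At `y` and at `z` row `m` does at least as
  -- well as row `i`; the midpoint gives the reverse for the sum, so both comparisons are
  -- equalities.
  midpoint-face : ∀ {y z i m j} → Attains y m j → Attains z m j →
                  Attains (midpoint y z) i j → Attains y i j × Attains z i j
  midpoint-face {y} {z} {i} {m} {j} hy hz h =
    attains-transfer hy (+-squeezeˡ-≤ sums (hz i)) , attains-transfer hz (+-squeezeʳ-≤ sums (hy i))
    where
    sums : (v i j + y m) + (v i j + z m) ≤ (v m j + y i) + (v m j + z i)
    sums = *-cancelˡ-≤ (begin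
      proj₁ halves * ((v i j + y m) + (v i j + z m)) ≈⟨ a+h*[x+y]≈h*[[a+x]+[a+y]] (v i j) (y m) (z m) ⟨
      v i j + midpoint y z m                         ≤⟨ h m ⟩
      v m j + midpoint y z i                         ≈⟨ a+h*[x+y]≈h*[[a+x]+[a+y]] (v m j) (y i) (z i) ⟩
      proj₁ halves * ((v m j + y i) + (v m j + z i)) ∎)

  -- Plays the role of a relative interior point. `genericPoint` applies to the `d * n` sectors,
  -- numbered through `remQuot`, because a cell is an intersection of sectors and so closed under
  -- midpoints.
  cell-generic : ∀ {C} → IsCell V C → ∃[ z ] z ∈ C ×
    (∀ i j → z ∈ Sector (column V j) i → C ⊆ Sector (column V j) i)
  cell-generic {C} (D , D-cell , (C⊆D , D⊆C) , sat) =
    let z , z∈C , gen = genericPoint em C (λ x → S (remQuot {d} n x)) mid sat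
    in z , z∈C , λ i j → ≡.subst (λ p → z ∈ S p → C ⊆ S p)
         (Fin.remQuot-combine i j) (gen (combine i j))
    where
    S : Fin d × Fin n → Pred (Point d) 0ℓ
    S p = Sector (column V (proj₂ p)) (proj₁ p)
    in-sector : ∀ {y} → y ∈ C → ∀ j i → i ∈ proj₁ (D-cell j) → Attains y i j
    in-sector y∈C j i i∈I = let _ , _ , _ , D⊆S , _ = D-cell j in
      sector⇒attains (D⊆S (C⊆D y∈C j) i i∈I)
    mid : ∀ y z → y ∈ C → z ∈ C → ∃[ m ] m ∈ C ×
          (∀ x → m ∈ S (remQuot {d} n x) → y ∈ S (remQuot {d} n x) × z ∈ S (remQuot {d} n x))
    mid y z y∈C z∈C = midpoint y z , D⊆C (λ j → let _ , _ , _ , _ , S⊆D = D-cell j in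
        S⊆D (λ i i∈I → attains⇒sector (midpoint-attains
          (in-sector y∈C j i i∈I) (in-sector z∈C j i i∈I)))) ,
      λ x m∈S → let
          i , j = remQuot {d} n x
          -- The index set of a cell of the complex of column `j` is nonempty, so `C` lies in some
          -- sector `m` of that column, as `midpoint-face` requires.
          _ , (m , m∈I) , _ = D-cell j
          hy , hz = midpoint-face (in-sector y∈C j m m∈I) (in-sector z∈C j m m∈I) (sector⇒attains m∈S)
        in attains⇒sector hy , attains⇒sector hz

  pureFullDimensional : ∀ Ψ → PureFullDimensional V Ψ
  pureFullDimensional Ψ C ((C-cell , C⊆thalf) , maximal) =
    let z , z∈C , gen = cell-generic C-cell in at-genericPoint z z∈C gen
    where
    at-genericPoint : ∀ z → z ∈ C →
      (∀ i j → z ∈ Sector (column V j) i → C ⊆ Sector (column V j) i) → HasDimension C d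
    at-genericPoint z z∈C gen =
      -- Maximality yields `cell ⊆ C`, which carries the simplex from `cell` into `C`.
      hasDimension (proj₂ (maximal cell (cell-isCell , cell⊆thalf) C⊆cell))
      where
      f : Fin n → Fin d
      f j = proj₁ (C⊆thalf z∈C j)
      z∈sector : ∀ j → z ∈ Sector (column V j) (f j)
      z∈sector j = proj₂ (proj₂ (C⊆thalf z∈C j))
      open Perturbation z f (λ j → sector⇒attains (z∈sector j))
      C⊆cell : C ⊆ cell
      C⊆cell y∈C j = gen (f j) j (z∈sector j) y∈C
      cell⊆thalf : cell ⊆ thalf V Ψ
      cell⊆thalf y∈cell j = f j , proj₁ (proj₂ (C⊆thalf z∈C j)) , y∈cell j
      cell-isCell : IsCell V cell
      cell-isCell = (λ j → Sector (column V j) (f j)) ,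
        (λ j → (λ i → i ≡ f j) , (f j , ≡.refl) ,
          (λ { _ ≡.refl → v (f j) j , V≡v (f j) j }) ,
          (λ { h _ ≡.refl → h }) , λ h → h (f j) ≡.refl) ,
        ((λ h → h) , λ h → h) , z , z∈sector

-- Finiteness of generic matrices, and the conclusion.

module _ (ℝ : CompleteOrderedField) where

  open CompleteOrderedField ℝ using (Carrier; _+_; 0#)
  open Tropical ℝ

  generic⇒finite : ∀ {d n} (V : Matrix d n) → TropicallyGeneric V → ∀ i j → ∃[ a ] V i j ≡ [ a ]
  generic⇒finite V generic i j = finite (V i j) ≡.refl
    where
    Fin1-injective : ∀ {A : Set} {x : A} → Injective _≡_ _≡_ (λ (_ : Fin 1) → x)
    Fin1-injective {x = _} {zero} {zero} _ = ≡.refl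
    finite : ∀ t → V i j ≡ t → ∃[ a ] t ≡ [ a ]
    finite (just a) _  = a , ≡.refl
    finite nothing  eq = ⊥-elim (generic 1 (λ _ → i) (λ _ → j) Fin1-injective Fin1-injective
      ( ⊤⁺
      , ( (λ π → ≡.subst (⊤⁺ ≤⁺_) (≡.sym weight≡⊤) (⊤⁺ ≤⊤⁺))
        , Permutation.id , ≡.subst (_≈⁺ ⊤⁺) (≡.sym weight≡⊤) Equality.⊤⁺≈⊤⁺ )
      , inj₁ ≡.refl))
      where
      -- A sum over `Fin 1` unfolds to its single entry combined with the unit `[ 0# ]`.
      weight≡⊤ : zipWith _+_ (V i j) [ 0# ] ≡ ⊤⁺
      weight≡⊤ = ≡.cong (λ t → zipWith _+_ t [ 0# ]) eq

theorem45 : ExcludedMiddle 0ℓ → (ℝ : CompleteOrderedField) →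
    let open Tropical ℝ in
    (d n : ℕ) (V : Matrix d n) (Ψ : Subgraph d n) →
    (∀ j → ∃[ i ] ∃[ a ] V i j ≡ [ a ]) →
    TropicallyGeneric V →
    PureFullDimensional V Ψ
theorem45 em ℝ d n V Ψ _ generic = Covectors.pureFullDimensional em ℝ V
  (λ i j → proj₁ (generic⇒finite ℝ V generic i j))
  (λ i j → proj₂ (generic⇒finite ℝ V generic i j))
  generic Ψ
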